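{- For every positive integer $m$, \[\nu(m)\geq 3\prod_{i=0}^{\lceil m/3\rceil-2} (m-3i),\] where an empty product equals $1$.
   Context: A matroid on a finite set $S$ is a family $\mathcal{M}$ of subsets of $S$ with $\emptyset\in\mathcal{M}$, closed under subsets, such that for every $A\subseteq S$ all maximal members of $\mathcal{M}$ contained in $A$ have the same cardinality. For a finite simple graph $G=(V,E)$, $M(G)$ is the family of all matchings (sets of pairwise disjoint edges) of $G$, and $\mu(G)$ is the minimum $m\in\mathbb{N}$ such that $M(G)$ is the intersection $\mathcal{M}_1\cap\dots\cap\mathcal{M}_m$ of $m$ matroids on $E$. For $n\in\mathbb{N}$, $\mu(n)=\max\{\mu(G): G \text{ a finite simple graph with } |V|\le n\}$, and for $m\in\mathbb{N}$, $\nu(m)=\sup\{n\in\mathbb{N}:\mu(n)\le m\}$. -}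

module Defs where

open import Data.Nat using (ℕ; zero; suc; _+_; _*_; _∸_; _≤_)
open import Data.Nat.DivMod using (_/_)
open import Data.Fin using (Fin)
open import Data.Fin.Subset using (Subset; ⊥; _⊆_; _∈_; ∣_∣)
open import Data.Product using (Σ; _×_; _,_)
open import Data.Sum using (_⊎_)
open import Relation.Binary.PropositionalEquality using (_≡_; _≢_)
open import Relation.Nullary using (¬_)

Family : ℕ → Set₁
Family k = Subset k → Set

MaximalIn : ∀ {k} → Family k → Subset k → Subset k → Set
MaximalIn F A X = X ⊆ A × F X × (∀ Z → X ⊆ Z → Z ⊆ A → F Z → Z ≡ X)

record IsMatroid {k : ℕ} (F : Family k) : Set where
  field
    empty∈   : F ⊥
    down     : ∀ X Y → Y ⊆ X → F X → F Y
    equicard : ∀ A X Y → MaximalIn F A X → MaximalIn F A Y → ∣ X ∣ ≡ ∣ Y ∣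

SameEnds : ∀ {v} → Fin v → Fin v → Fin v → Fin v → Set
SameEnds a b c d = (a ≡ c × b ≡ d) ⊎ (a ≡ d × b ≡ c)

record Graph : Set where
  field
    nV  : ℕ
    nE  : ℕ
    end₁ : Fin nE → Fin nV
    end₂ : Fin nE → Fin nV
    loopless : ∀ e → end₁ e ≢ end₂ e
    simple   : ∀ e e' → SameEnds (end₁ e) (end₂ e) (end₁ e') (end₂ e') → e ≡ e'

Disjoint : (G : Graph) → Fin (Graph.nE G) → Fin (Graph.nE G) → Set
Disjoint G e e' =
  end₁ e ≢ end₁ e' × end₁ e ≢ end₂ e' × end₂ e ≢ end₁ e' × end₂ e ≢ end₂ e'
  where open Graph G

Matching : (G : Graph) → Family (Graph.nE G)
Matching G X = ∀ e e' → e ∈ X → e' ∈ X → e ≢ e' → Disjoint G e e'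

IsIntersectionOf : (G : Graph) → (j : ℕ) → (Fin j → Family (Graph.nE G)) → Set
IsIntersectionOf G j Ms =
  (∀ i → IsMatroid (Ms i)) ×
  (∀ X → (Matching G X → ∀ i → Ms i X) × ((∀ i → Ms i X) → Matching G X))

-- μ(G) ≤ m  (μ(G) is the minimum number of matroids; so μ(G) ≤ m iff
-- M(G) is an intersection of some j ≤ m matroids)
μG≤ : Graph → ℕ → Set₁
μG≤ G m = Σ ℕ λ j → j ≤ m × Σ (Fin j → Family (Graph.nE G)) λ Ms → IsIntersectionOf G j Ms

-- μ(n) ≤ m  (μ(n) is a maximum over graphs with at most n vertices)
μ≤ : ℕ → ℕ → Set₁
μ≤ n m = ∀ (G : Graph) → Graph.nV G ≤ n → μG≤ G m

-- ν(m) ≥ K, where ν(m) = sup {n ∈ ℕ : μ(n) ≤ m} (a sup of naturals,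
-- possibly infinite): some n ≥ K has μ(n) ≤ m.
ν≥ : ℕ → ℕ → Set₁
ν≥ m K = Σ ℕ λ n → K ≤ n × μ≤ n m

⌈_/3⌉ : ℕ → ℕ
⌈ m /3⌉ = (m + 2) / 3

∏< : ℕ → (ℕ → ℕ) → ℕ
∏< zero    f = 1
∏< (suc t) f = ∏< t f * f t

bound : ℕ → ℕ
bound m = 3 * ∏< (⌈ m /3⌉ ∸ 1) (λ i → m ∸ 3 * i)

{-# OPTIONS --safe #-}

-- Two distinct edges excluded together by a matroid containing all matchings
-- must meet, so the task is to find m partitions of the edges of K_n into
-- stars and triangles such that any two edges with a common vertex lie in one
-- class of some partition; the partition matroids of these then do the job.
-- For n = 3 a single class suffices.  Given a solution with n vertices and m
-- partitions, take M = m + 3 blocks of n vertices, indexed, as are the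
-- partitions, by ℤ/M.  A block a uses the m partitions i with a + i ∉ {0,1,2}
-- to run the given solution on its inner edges; in the remaining three its
-- inner edges form stars centred at their smaller (a + i = 0) or larger
-- (a + i = 1, 2) ends.  An edge joining two blocks belongs to the star of its
-- end in the block where a + i comes first in the order 0, 2, 1, 3, 4, ….
-- This gives ν(m + 3) ≥ (m + 3) ν(m).
module Submission where

open import Defs
open import Data.Bool using (true; false; if_then_else_)
open import Data.Fin using (Fin; zero; suc; toℕ; inject≤; remQuot; combine)
open import Data.Fin.Properties as Fin using (any?; all?; toℕ<n; toℕ-fromℕ<; toℕ-injective; inject≤-injective; combine-remQuot)
open import Data.Fin.Subset using (Subset; ⁅_⁆; _∈_; _∪_; _-_; _⊆_; ∣_∣; inside; outside)
open import Data.Fin.Subset.Properties using (_∈?_; ∉⊥; x∈⁅x⁆; x∈⁅y⁆⇒x≡y; x∈p∪q⁻; p⊆p∪q; q⊆p∪q; x∈p∧x≢y⇒x∈p-y; x∈p⇒∣p-x∣<∣p∣)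
open import Data.Nat using (ℕ; zero; suc; _+_; _*_; _∸_; _≤_; _<_; _<?_; z≤n; s≤s; NonZero)
open import Data.Nat.Divisibility using (divides-refl)
open import Data.Nat.DivMod using (_%_; _mod_; m%n<n; m%n%n≡m%n; %-distribˡ-+; [m+n]%n≡m%n; m<n⇒m%n≡m; +-distrib-/-∣ˡ; m≥n⇒m/n>0)
open import Data.Nat.Properties using (≤-refl; ≤-trans; ≤-antisym; <⇒≤; <-cmp; <-asym; ≤∧≢⇒<; +-comm; +-assoc; *-comm; *-assoc; *-suc; m≤n+m; ∸-cancelˡ-≡; m+[n∸m]≡n; ∸-monoʳ-<; +-cancelˡ-≡; [m+n]∸[m+o]≡n∸o)
open import Data.Product using (∃; _×_; _,_; proj₁; proj₂; uncurry)
open import Data.Product.Properties using () renaming (≡-dec to ×-≡-dec)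
open import Data.Sum using (_⊎_; inj₁; inj₂)
open import Data.Sum.Properties using () renaming (≡-dec to ⊎-≡-dec)
open import Data.Unit using (⊤; tt)
open import Data.Vec using ([]; _∷_; here; there)
open import Function using (_∘_)
open import Relation.Binary.Definitions using (DecidableEquality; tri<; tri≈; tri>)
open import Relation.Binary.PropositionalEquality using (_≡_; _≢_; refl; sym; trans; cong; cong₂; subst; subst₂; module ≡-Reasoning)
open import Relation.Nullary using (¬_; Dec; yes; no; does; contradiction)
open import Relation.Nullary.Decidable using (_×-dec_; ¬?; _→-dec_; _⊎-dec_; decidable-stable; from-yes; dec-true; dec-false)

private
  variable
    k l m n : ℕ
    V W : Set

-- Partition matroids

-- Induction on `X`: the partner `y₀` of the first member is struck from `Y`, and injectivity of `R`
-- keeps the other partners away from `y₀`.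
∣∣-mono-injection : (R : Fin k → Fin l → Set) (X : Subset k) (Y : Subset l) →
  (∀ {x} → x ∈ X → ∃ λ y → y ∈ Y × R x y) →
  (∀ {x x' y} → x ∈ X → x' ∈ X → R x y → R x' y → x ≡ x') →
  ∣ X ∣ ≤ ∣ Y ∣
∣∣-mono-injection R [] Y f inj = z≤n
∣∣-mono-injection R (outside ∷ X) Y f inj =
  ∣∣-mono-injection (R ∘ suc) X Y (f ∘ there)
    (λ p q r s → Fin.suc-injective (inj (there p) (there q) r s))
∣∣-mono-injection R (inside ∷ X) Y f inj with f here
... | y₀ , y₀∈Y , r₀ =
  ≤-trans (s≤s (∣∣-mono-injection (R ∘ suc) X (Y - y₀) g
            (λ p q r s → Fin.suc-injective (inj (there p) (there q) r s))))
          (x∈p⇒∣p-x∣<∣p∣ y₀∈Y)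
  where
  g : ∀ {x} → x ∈ X → ∃ λ y → y ∈ Y - y₀ × R (suc x) y
  g x∈X with f (there x∈X)
  ... | y , y∈Y , r = y , x∈p∧x≢y⇒x∈p-y y∈Y y≢y₀ , r
    where
    y≢y₀ : y ≢ y₀
    y≢y₀ refl with inj here (there x∈X) r₀ r
    ... | ()

module _ {C : Set} (_≟_ : DecidableEquality C) (c : Fin k → C) where

  Transversal : Family k
  Transversal X = ∀ {e e'} → e ∈ X → e' ∈ X → c e ≡ c e' → e ≡ e'

  -- If no member of `X` had the colour of `e`, adding `e` would give a larger transversal inside
  -- `A`. Decidability of colours turns this into a witness.
  maximal-represents : ∀ {A X} → MaximalIn Transversal A X →
    ∀ {e} → e ∈ A → ∃ λ e' → e' ∈ X × c e ≡ c e'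
  maximal-represents {A} {X} (X⊆A , tX , maxX) {e} e∈A =
    decidable-stable (any? λ e' → (e' ∈? X) ×-dec (c e ≟ c e')) λ none →
      none (e , subst (e ∈_) (maxX Z (p⊆p∪q ⁅ e ⁆) Z⊆A (tZ none)) (q⊆p∪q X ⁅ e ⁆ (x∈⁅x⁆ e)) , refl)
    where
    Z : Subset k
    Z = X ∪ ⁅ e ⁆

    Z⊆A : Z ⊆ A
    Z⊆A f∈Z with x∈p∪q⁻ X ⁅ e ⁆ f∈Z
    ... | inj₁ f∈X = X⊆A f∈X
    ... | inj₂ f∈e rewrite x∈⁅y⁆⇒x≡y e f∈e = e∈A

    tZ : _ → Transversal Z
    tZ none f∈Z f'∈Z eq with x∈p∪q⁻ X ⁅ e ⁆ f∈Z | x∈p∪q⁻ X ⁅ e ⁆ f'∈Z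
    ... | inj₁ f∈X | inj₁ f'∈X = tX f∈X f'∈X eq
    ... | inj₁ f∈X | inj₂ f'∈e rewrite x∈⁅y⁆⇒x≡y e f'∈e = contradiction (_ , f∈X , sym eq) none
    ... | inj₂ f∈e | inj₁ f'∈X rewrite x∈⁅y⁆⇒x≡y e f∈e = contradiction (_ , f'∈X , eq) none
    ... | inj₂ f∈e | inj₂ f'∈e = trans (x∈⁅y⁆⇒x≡y e f∈e) (sym (x∈⁅y⁆⇒x≡y e f'∈e))

  maximal-∣∣≤ : ∀ {A X Y} → MaximalIn Transversal A X → MaximalIn Transversal A Y → ∣ X ∣ ≤ ∣ Y ∣
  maximal-∣∣≤ {X = X} {Y} (X⊆A , tX , _) maxY =
    ∣∣-mono-injection (λ x y → c x ≡ c y) X Y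
      (maximal-represents maxY ∘ X⊆A) (λ p q r s → tX p q (trans r (sym s)))

  transversal-isMatroid : IsMatroid Transversal
  transversal-isMatroid = record
    { empty∈   = λ e∈⊥ → contradiction e∈⊥ ∉⊥
    ; down     = λ X Y Y⊆X tX p q → tX (Y⊆X p) (Y⊆X q)
    ; equicard = λ A X Y maxX maxY → ≤-antisym (maximal-∣∣≤ maxX maxY) (maximal-∣∣≤ maxY maxX)
    }

-- Star-triangle covers

Meet : V → V → V → V → Set
Meet u v u' v' = (u ≡ u' ⊎ u ≡ v') ⊎ (v ≡ u' ⊎ v ≡ v')

-- m partitions of the edges of the complete graph on V; classes of pairwise
-- meeting edges are exactly the stars, the triangles and their subsets.  The
-- values class i u u are junk.
record Cover (V : Set) (m : ℕ) : Set₁ where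
  field
    Class      : Set
    _≟_        : DecidableEquality Class
    class      : Fin m → V → V → Class
    class-sym  : ∀ i {u v} → u ≢ v → class i u v ≡ class i v u
    class-meet : ∀ i {u v u' v'} → class i u v ≡ class i u' v' →
                 u ≢ v → u' ≢ v' → Meet u v u' v'
    covers     : ∀ {u v w} → u ≢ v → u ≢ w → ∃ λ i → class i u v ≡ class i u w

pullback : (f : W → V) → (∀ {x y} → f x ≡ f y → x ≡ y) → Cover V m → Cover W m
pullback f inj C = record
  { Class      = Class
  ; _≟_        = _≟_
  ; class      = λ i x y → class i (f x) (f y)
  ; class-sym  = λ i x≢y → class-sym i (x≢y ∘ inj)
  ; class-meet = λ i eq p q → reflect (class-meet i eq (p ∘ inj) (q ∘ inj))
  ; covers     = λ p q → covers (p ∘ inj) (q ∘ inj)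
  }
  where
  open Cover C
  reflect : ∀ {x y x' y'} → Meet (f x) (f y) (f x') (f y') → Meet x y x' y'
  reflect (inj₁ (inj₁ p)) = inj₁ (inj₁ (inj p))
  reflect (inj₁ (inj₂ p)) = inj₁ (inj₂ (inj p))
  reflect (inj₂ (inj₁ p)) = inj₂ (inj₁ (inj p))
  reflect (inj₂ (inj₂ p)) = inj₂ (inj₂ (inj p))

-- Matroid `i` allows at most one edge from each class of partition `i`. By `class-meet`, distinct
-- edges of a matching never share a class; by `covers`, edges with a common end share one.
cover⇒μG≤ : (G : Graph) → Cover (Fin (Graph.nV G)) m → μG≤ G m
cover⇒μG≤ {m} G C =
  m , ≤-refl , (λ i → Transversal _≟_ (colour i)) ,
  (λ i → transversal-isMatroid _≟_ (colour i)) ,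
  (λ X → matching⇒transversal X , transversals⇒matching X)
  where
  open Graph G
  open Cover C

  colour : Fin m → Fin nE → Class
  colour i e = class i (end₁ e) (end₂ e)

  meet⇒¬disjoint : ∀ {e e'} → Meet (end₁ e) (end₂ e) (end₁ e') (end₂ e') →
                   ¬ Disjoint G e e'
  meet⇒¬disjoint (inj₁ (inj₁ p)) (q , _) = q p
  meet⇒¬disjoint (inj₁ (inj₂ p)) (_ , q , _) = q p
  meet⇒¬disjoint (inj₂ (inj₁ p)) (_ , _ , q , _) = q p
  meet⇒¬disjoint (inj₂ (inj₂ p)) (_ , _ , _ , q) = q p

  matching⇒transversal : ∀ X → Matching G X → ∀ i → Transversal _≟_ (colour i) X
  matching⇒transversal X M i {e} {e'} e∈X e'∈X eq = decidable-stable (e Fin.≟ e') λ e≢e' →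
    meet⇒¬disjoint (class-meet i eq (loopless e) (loopless e')) (M e e' e∈X e'∈X e≢e')

  -- Reading edges in both directions turns the four inequalities of `Disjoint` into the single
  -- claim `apart`.
  data Ends (e : Fin nE) : Fin nV → Fin nV → Set where
    forth : Ends e (end₁ e) (end₂ e)
    back  : Ends e (end₂ e) (end₁ e)

  ends-≢ : ∀ {e u v} → Ends e u v → u ≢ v
  ends-≢ {e} forth = loopless e
  ends-≢ {e} back  = loopless e ∘ sym

  ends-colour : ∀ {e u v} → Ends e u v → ∀ i → colour i e ≡ class i u v
  ends-colour {e} forth i = refl
  ends-colour {e} back  i = class-sym i (loopless e)

  transversals⇒matching : ∀ X → (∀ i → Transversal _≟_ (colour i) X) → Matching G X
  transversals⇒matching X T e e' e∈X e'∈X e≢e' =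
    apart forth forth , apart forth back , apart back forth , apart back back
    where
    apart : ∀ {u v u' v'} → Ends e u v → Ends e' u' v' → u ≢ u'
    apart E E' refl with covers (ends-≢ E) (ends-≢ E')
    ... | i , eq = e≢e' (T i e∈X e'∈X (trans (ends-colour E i) (trans eq (sym (ends-colour E' i)))))

cover⇒ν≥ : Cover (Fin n) m → ν≥ m n
cover⇒ν≥ {n} C = n , ≤-refl , λ G nV≤n →
  cover⇒μG≤ G (pullback (λ x → inject≤ x nV≤n) (inject≤-injective nV≤n nV≤n _ _) C)

-- Any two edges of a triangle meet, as enumeration confirms. The form `suc m` guarantees an index
-- for `covers`.
triangle-cover : ∀ m → Cover (Fin 3) (suc m)
triangle-cover m = record
  { Class      = ⊤
  ; _≟_        = λ _ _ → yes refl
  ; class      = λ _ _ _ → tt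
  ; class-sym  = λ _ _ → refl
  ; class-meet = λ _ _ → meet _ _ _ _
  ; covers     = λ _ _ → zero , refl
  }
  where
  meet : ∀ (u v u' v' : Fin 3) → u ≢ v → u' ≢ v' → Meet u v u' v'
  meet = from-yes (all? {n = 3} λ u → all? λ v → all? λ u' → all? λ v' →
    ¬? (u Fin.≟ v) →-dec ¬? (u' Fin.≟ v') →-dec
    ((u Fin.≟ u' ⊎-dec u Fin.≟ v') ⊎-dec (v Fin.≟ u' ⊎-dec v Fin.≟ v')))

-- Addition modulo M

[m%n+o]%n≡[m+o]%n : ∀ m n o .{{_ : NonZero n}} → (m % n + o) % n ≡ (m + o) % n
[m%n+o]%n≡[m+o]%n m n o = begin
  (m % n + o) % n         ≡⟨ %-distribˡ-+ (m % n) o n ⟩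
  (m % n % n + o % n) % n ≡⟨ cong (λ r → (r + o % n) % n) (m%n%n≡m%n m n) ⟩
  (m % n + o % n) % n     ≡⟨ %-distribˡ-+ m o n ⟨
  (m + o) % n             ∎
  where open ≡-Reasoning

module _ {M : ℕ} .{{_ : NonZero M}} where

  infixl 6 _⊕_

  _⊕_ : Fin M → Fin M → Fin M
  a ⊕ b = (toℕ a + toℕ b) mod M

  toℕ-mod : ∀ x → toℕ (x mod M) ≡ x % M
  toℕ-mod x = toℕ-fromℕ< (m%n<n x M)

  toℕ-% : ∀ (a : Fin M) → toℕ a % M ≡ toℕ a
  toℕ-% a = m<n⇒m%n≡m (toℕ<n a)

  -- Adding a complement replaces subtraction, both in solving for an index and in cancelling one.
  %-+-cancel : ∀ (d : Fin M) {b c} → b + c ≡ M → ((toℕ d + b) % M + c) % M ≡ toℕ d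
  %-+-cancel d {b} {c} b+c≡M = begin
    ((toℕ d + b) % M + c) % M ≡⟨ [m%n+o]%n≡[m+o]%n (toℕ d + b) M c ⟩
    (toℕ d + b + c) % M       ≡⟨ cong (_% M) (+-assoc (toℕ d) b c) ⟩
    (toℕ d + (b + c)) % M     ≡⟨ cong (λ x → (toℕ d + x) % M) b+c≡M ⟩
    (toℕ d + M) % M           ≡⟨ [m+n]%n≡m%n (toℕ d) M ⟩
    toℕ d % M                 ≡⟨ toℕ-% d ⟩
    toℕ d                     ∎
    where open ≡-Reasoning

  toℕ+complement : ∀ (a : Fin M) → toℕ a + (M ∸ toℕ a) ≡ M
  toℕ+complement a = m+[n∸m]≡n (<⇒≤ (toℕ<n a))

  ⊕-solve : ∀ a d → ∃ λ i → a ⊕ i ≡ d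
  ⊕-solve a d = i , toℕ-injective (begin
    toℕ (a ⊕ i)                             ≡⟨ toℕ-mod _ ⟩
    (toℕ a + toℕ i) % M                     ≡⟨ cong (λ x → (toℕ a + x) % M) (toℕ-mod _) ⟩
    (toℕ a + (toℕ d + (M ∸ toℕ a)) % M) % M ≡⟨ cong (_% M) (+-comm (toℕ a) _) ⟩
    ((toℕ d + (M ∸ toℕ a)) % M + toℕ a) % M
      ≡⟨ %-+-cancel d (trans (+-comm (M ∸ toℕ a) (toℕ a)) (toℕ+complement a)) ⟩
    toℕ d                                   ∎)
    where
    open ≡-Reasoning
    i : Fin M
    i = (toℕ d + (M ∸ toℕ a)) mod M

  ⊕-cancelʳ : ∀ {a b} i → a ⊕ i ≡ b ⊕ i → a ≡ b
  ⊕-cancelʳ {a} {b} i eq = toℕ-injective (begin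
    toℕ a                                   ≡⟨ %-+-cancel a (toℕ+complement i) ⟨
    ((toℕ a + toℕ i) % M + (M ∸ toℕ i)) % M ≡⟨ cong (λ x → (x + (M ∸ toℕ i)) % M) eq% ⟩
    ((toℕ b + toℕ i) % M + (M ∸ toℕ i)) % M ≡⟨ %-+-cancel b (toℕ+complement i) ⟩
    toℕ b                                   ∎)
    where
    open ≡-Reasoning
    eq% : (toℕ a + toℕ i) % M ≡ (toℕ b + toℕ i) % M
    eq% = trans (sym (toℕ-mod _)) (trans (cong toℕ eq) (toℕ-mod _))

  ⊕-assoc : ∀ a b c → (a ⊕ b) ⊕ c ≡ a ⊕ (b ⊕ c)
  ⊕-assoc a b c = toℕ-injective (begin
    toℕ ((a ⊕ b) ⊕ c)                   ≡⟨ toℕ-mod _ ⟩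
    (toℕ (a ⊕ b) + toℕ c) % M           ≡⟨ cong (λ x → (x + toℕ c) % M) (toℕ-mod _) ⟩
    ((toℕ a + toℕ b) % M + toℕ c) % M   ≡⟨ [m%n+o]%n≡[m+o]%n (toℕ a + toℕ b) M (toℕ c) ⟩
    (toℕ a + toℕ b + toℕ c) % M         ≡⟨ cong (_% M) (+-assoc (toℕ a) (toℕ b) (toℕ c)) ⟩
    (toℕ a + (toℕ b + toℕ c)) % M       ≡⟨ cong (_% M) (+-comm (toℕ a) (toℕ b + toℕ c)) ⟩
    (toℕ b + toℕ c + toℕ a) % M         ≡⟨ [m%n+o]%n≡[m+o]%n (toℕ b + toℕ c) M (toℕ a) ⟨
    ((toℕ b + toℕ c) % M + toℕ a) % M   ≡⟨ cong (_% M) (+-comm _ (toℕ a)) ⟩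
    (toℕ a + (toℕ b + toℕ c) % M) % M   ≡⟨ cong (λ x → (toℕ a + x) % M) (toℕ-mod _) ⟨
    (toℕ a + toℕ (b ⊕ c)) % M           ≡⟨ toℕ-mod _ ⟨
    toℕ (a ⊕ (b ⊕ c))                   ∎)
    where open ≡-Reasoning

-- The inductive step

minBy : (V → ℕ) → V → V → V
minBy key u v = if does (key u <? key v) then u else v

module _ (key : V → ℕ) where

  minBy-left : ∀ {u v} → key u < key v → minBy key u v ≡ u
  minBy-left {u} {v} lt rewrite dec-true (key u <? key v) lt = refl

  minBy-right : ∀ {u v} → key v < key u → minBy key u v ≡ v
  minBy-right {u} {v} gt rewrite dec-false (key u <? key v) (<-asym gt) = refl

  minBy-comm : ∀ {u v} → key u ≢ key v → minBy key u v ≡ minBy key v u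
  minBy-comm {u} {v} ≢ with <-cmp (key u) (key v)
  ... | tri< lt _ _ = trans (minBy-left lt) (sym (minBy-right lt))
  ... | tri≈ _ eq _ = contradiction eq ≢
  ... | tri> _ _ gt = trans (minBy-right gt) (sym (minBy-left gt))

  minBy-sel : ∀ u v → minBy key u v ≡ u ⊎ minBy key u v ≡ v
  minBy-sel u v with does (key u <? key v)
  ... | true  = inj₁ refl
  ... | false = inj₂ refl

-- Call a + i the position of block a at index i. In the natural order block a - 1 would precede
-- block a at both positions 1 and 2, where inner stars have larger ends as centres; exchanging 1
-- and 2 prevents this.
rank : Fin (4 + m) → ℕ
rank zero                = 0
rank (suc zero)          = 2
rank (suc (suc zero))    = 1
rank (suc (suc (suc d))) = 3 + toℕ d

rank-injective : ∀ {d e : Fin (4 + m)} → rank d ≡ rank e → d ≡ e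
rank-injective {d = zero} {zero} eq = refl
rank-injective {d = zero} {suc zero} ()
rank-injective {d = zero} {suc (suc zero)} ()
rank-injective {d = suc zero} {zero} ()
rank-injective {d = suc zero} {suc zero} eq = refl
rank-injective {d = suc zero} {suc (suc zero)} ()
rank-injective {d = suc (suc zero)} {suc zero} ()
rank-injective {d = suc (suc zero)} {suc (suc zero)} eq = refl
rank-injective {d = suc (suc (suc d))} {suc (suc (suc e))} eq =
  cong (λ x → suc (suc (suc x))) (toℕ-injective (+-cancelˡ-≡ 3 _ _ eq))

-- Classes on the blocks: symmetry and meeting

module Blowup {m n : ℕ} (C : Cover (Fin n) (suc m)) where
  open Cover C

  M : ℕ
  M = 4 + m

  Vertex : Set
  Vertex = Fin M × Fin n

  level : Fin M → Vertex → ℕ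
  level i (a , _) = rank (a ⊕ i)

  level-injective : ∀ i {p q} → level i p ≡ level i q → proj₁ p ≡ proj₁ q
  level-injective i eq = ⊕-cancelʳ i (rank-injective eq)

  -- Reverses the order of `Fin n`, so that the lemmas on `minBy` also serve for larger ends.
  depth : Fin n → ℕ
  depth x = n ∸ toℕ x

  min max : Fin n → Fin n → Fin n
  min = minBy toℕ
  max = minBy depth

  -- `inj₁ p` names the star centred at `p`, so inner and crossing edges can share it. The block in
  -- the other summand keeps copies of one class in different blocks apart.
  Class' : Set
  Class' = Vertex ⊎ (Fin M × Class)

  inner : Fin M → Fin M → Fin n → Fin n → Class'
  inner zero                a x y = inj₁ (a , min x y)
  inner (suc zero)          a x y = inj₁ (a , max x y)
  inner (suc (suc zero))    a x y = inj₁ (a , max x y)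
  inner (suc (suc (suc j))) a x y = inj₂ (a , class j x y)

  class' : Fin M → Vertex → Vertex → Class'
  class' i (a , x) (b , y) with a Fin.≟ b
  ... | yes _ = inner (a ⊕ i) a x y
  ... | no _  = inj₁ (minBy (level i) (a , x) (b , y))

  class'-within : ∀ i a x y → class' i (a , x) (a , y) ≡ inner (a ⊕ i) a x y
  class'-within i a x y with a Fin.≟ a
  ... | yes _   = refl
  ... | no a≢a = contradiction refl a≢a

  class'-across : ∀ i {a b x y} → a ≢ b → class' i (a , x) (b , y) ≡ inj₁ (minBy (level i) (a , x) (b , y))
  class'-across i {a} {b} a≢b with a Fin.≟ b
  ... | yes a≡b = contradiction a≡b a≢b
  ... | no _    = refl

  max-comm : ∀ {x y} → x ≢ y → max x y ≡ max y x
  max-comm {x} {y} x≢y = minBy-comm depth {x} {y} λ eq →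
    x≢y (toℕ-injective (∸-cancelˡ-≡ (<⇒≤ (toℕ<n x)) (<⇒≤ (toℕ<n y)) eq))

  inner-sym : ∀ d a {x y} → x ≢ y → inner d a x y ≡ inner d a y x
  inner-sym zero a x≢y = cong (λ z → inj₁ (a , z)) (minBy-comm toℕ (x≢y ∘ toℕ-injective))
  inner-sym (suc zero) a x≢y = cong (λ z → inj₁ (a , z)) (max-comm x≢y)
  inner-sym (suc (suc zero)) a x≢y = cong (λ z → inj₁ (a , z)) (max-comm x≢y)
  inner-sym (suc (suc (suc j))) a x≢y = cong (λ c → inj₂ (a , c)) (class-sym j x≢y)

  -- Retains from `class'` only what meeting needs: a star's centre is an end of the edge, whichever
  -- rule chose it, and any other class comes from the given cover.
  data Shape (i : Fin M) : Vertex → Vertex → Class' → Set where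
    left   : ∀ {p q} → Shape i p q (inj₁ p)
    right  : ∀ {p q} → Shape i p q (inj₁ q)
    within : ∀ {a x y j} → a ⊕ i ≡ suc (suc (suc j)) → Shape i (a , x) (a , y) (inj₂ (a , class j x y))

  shape-minBy : ∀ i {a x y} (key : Fin n → ℕ) → Shape i (a , x) (a , y) (inj₁ (a , minBy key x y))
  shape-minBy i {a} {x} {y} key with minBy key x y | minBy-sel key x y
  ... | _ | inj₁ refl = left
  ... | _ | inj₂ refl = right

  shape-inner : ∀ i a x y {d} → a ⊕ i ≡ d → Shape i (a , x) (a , y) (inner d a x y)
  shape-inner i a x y {zero}              eq = shape-minBy i toℕ
  shape-inner i a x y {suc zero}          eq = shape-minBy i depth
  shape-inner i a x y {suc (suc zero)}    eq = shape-minBy i depth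
  shape-inner i a x y {suc (suc (suc j))} eq = within eq

  shape : ∀ i p q → Shape i p q (class' i p q)
  shape i (a , x) (b , y) with a Fin.≟ b
  ... | yes refl = shape-inner i a x y refl
  ... | no _ with minBy (level i) (a , x) (b , y) | minBy-sel (level i) (a , x) (b , y)
  ...   | _ | inj₁ refl = left
  ...   | _ | inj₂ refl = right

  shape-meet : ∀ {i p q p' q' c} → Shape i p q c → Shape i p' q' c →
               p ≢ q → p' ≢ q' → Meet p q p' q'
  shape-meet left  left  _ _ = inj₁ (inj₁ refl)
  shape-meet left  right _ _ = inj₁ (inj₂ refl)
  shape-meet right left  _ _ = inj₂ (inj₁ refl)
  shape-meet right right _ _ = inj₂ (inj₂ refl)
  -- The class values are linked by an equation, because `class j x y` and `class j' x' y'` cannot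
  -- be unified by matching.
  shape-meet s@(within _) s' p≢q p'≢q' = go s s' refl p≢q p'≢q'
    where
    go : ∀ {i p q p' q' c c'} → Shape i p q (inj₂ c) → Shape i p' q' (inj₂ c') → c ≡ c' →
         p ≢ q → p' ≢ q' → Meet p q p' q'
    go (within {a} {x} {y} {j} e) (within {a'} {x'} {y'} {j'} e') eq p≢q p'≢q'
      with cong proj₁ eq
    -- One block at one index has one position, so both edges use the same partition `j`.
    ... | refl with trans (sym e) e'
    ... | refl with class-meet j (cong proj₂ eq) (p≢q ∘ cong (a ,_)) (p'≢q' ∘ cong (a ,_))
    ... | inj₁ (inj₁ r) = inj₁ (inj₁ (cong (a ,_) r))
    ... | inj₁ (inj₂ r) = inj₁ (inj₂ (cong (a ,_) r))
    ... | inj₂ (inj₁ r) = inj₂ (inj₁ (cong (a ,_) r))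
    ... | inj₂ (inj₂ r) = inj₂ (inj₂ (cong (a ,_) r))

  class'-sym : ∀ i {p q} → p ≢ q → class' i p q ≡ class' i q p
  class'-sym i {a , x} {b , y} p≢q = by-block (a Fin.≟ b)
    where
    by-block : Dec (a ≡ b) → class' i (a , x) (b , y) ≡ class' i (b , y) (a , x)
    by-block (yes refl) = trans (class'-within i a x y)
      (trans (inner-sym (a ⊕ i) a (p≢q ∘ cong (a ,_))) (sym (class'-within i a y x)))
    by-block (no a≢b) = trans (class'-across i a≢b)
      (trans (cong inj₁ (minBy-comm (level i) (a≢b ∘ level-injective i {a , x} {b , y})))
             (sym (class'-across i (a≢b ∘ sym))))

  -- Common classes for edges with a common vertex

  owns : ∀ i {a b x y} → a ≢ b → rank (a ⊕ i) < rank (b ⊕ i) → class' i (a , x) (b , y) ≡ inj₁ (a , x)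
  owns i a≢b lt = trans (class'-across i a≢b) (cong inj₁ (minBy-left (level i) lt))

  -- Position `zero` has the least rank and distinct blocks have distinct positions, so one index
  -- serves all crossing edges at `(a , x)`.
  owns-all : ∀ i {a} → a ⊕ i ≡ zero → ∀ {b x y} → a ≢ b → class' i (a , x) (b , y) ≡ inj₁ (a , x)
  owns-all i {a} eq {b} a≢b = owns i a≢b (≤∧≢⇒< (subst (λ d → rank d ≤ rank (b ⊕ i)) (sym eq) z≤n)
    (a≢b ∘ ⊕-cancelʳ i ∘ rank-injective))

  one : Fin M
  one = suc zero

  IsUpper : Fin M → Set
  IsUpper d = d ≡ suc zero ⊎ d ≡ suc (suc zero)

  -- Index i = 2 − a serves unless b + i = 0; then b + (i − 1) = M − 1 > 2, as
  -- M ≥ 4, and index i − 1 = 1 − a serves.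
  upper : ∀ {a b} → a ≢ b → ∃ λ i → IsUpper (a ⊕ i) × rank (a ⊕ i) < rank (b ⊕ i)
  upper {a} {b} a≢b with ⊕-solve a one
  ... | i' , eq' = choose (b ⊕ i) (b ⊕ i') refl refl
    where
    i : Fin M
    i = i' ⊕ one

    a⊕i : a ⊕ i ≡ suc (suc zero)
    a⊕i = trans (sym (⊕-assoc a i' one)) (cong (_⊕ one) eq')

    at-i : rank (suc (suc (zero {n = suc m}))) < rank (b ⊕ i) → _
    at-i lt = i , inj₂ a⊕i , subst (λ d → rank d < rank (b ⊕ i)) (sym a⊕i) lt

    b⊕i : ∀ {d} → b ⊕ i' ≡ d → b ⊕ i ≡ d ⊕ one
    b⊕i eq = trans (sym (⊕-assoc b i' one)) (cong (_⊕ one) eq)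

    choose : ∀ d d' → b ⊕ i ≡ d → b ⊕ i' ≡ d' →
             ∃ λ i → IsUpper (a ⊕ i) × rank (a ⊕ i) < rank (b ⊕ i)
    choose (suc zero) _ eq _ = at-i (subst (λ d → 1 < rank d) (sym eq) (s≤s (s≤s z≤n)))
    choose (suc (suc zero)) _ eq _ = contradiction (⊕-cancelʳ i (trans a⊕i (sym eq))) a≢b
    choose (suc (suc (suc d))) _ eq _ = at-i (subst (λ d → 1 < rank d) (sym eq) (s≤s (s≤s z≤n)))
    choose zero zero eq e with trans (sym eq) (b⊕i e)
    ... | ()
    choose zero (suc zero) eq e with trans (sym eq) (b⊕i e)
    ... | ()
    choose zero (suc (suc zero)) eq e with trans (sym eq) (b⊕i e)
    ... | ()
    choose zero (suc (suc (suc d))) eq e =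
      i' , inj₁ eq' , subst₂ (λ d d' → rank d < rank d') (sym eq') (sym e) (s≤s (s≤s (s≤s z≤n)))

  inner-max : ∀ {d} → IsUpper d → ∀ a x y → inner d a x y ≡ inj₁ (a , max x y)
  inner-max (inj₁ refl) a x y = refl
  inner-max (inj₂ refl) a x y = refl

  -- The index must make `(a , x)` the centre for both edges. If `x` is the smaller end of the inner
  -- edge, position 0 does so for every `b`. If it is the larger, `upper` finds one of the positions
  -- 1 and 2 at which `a` precedes `b`.
  mixed : ∀ {a b x y z} → x ≢ y → a ≢ b →
          ∃ λ i → class' i (a , x) (a , y) ≡ class' i (a , x) (b , z)
  mixed {a} {b} {x} {y} {z} x≢y a≢b with <-cmp (toℕ x) (toℕ y)
  ... | tri≈ _ eq _ = contradiction (toℕ-injective eq) x≢y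
  ... | tri< lt _ _ with ⊕-solve a zero
  ...   | i , eq = i , (begin
    class' i (a , x) (a , y) ≡⟨ class'-within i a x y ⟩
    inner (a ⊕ i) a x y      ≡⟨ cong (λ d → inner d a x y) eq ⟩
    inj₁ (a , min x y)       ≡⟨ cong (λ w → inj₁ (a , w)) (minBy-left toℕ lt) ⟩
    inj₁ (a , x)             ≡⟨ owns-all i eq a≢b ⟨
    class' i (a , x) (b , z) ∎)
    where open ≡-Reasoning
  mixed {a} {b} {x} {y} {z} x≢y a≢b | tri> _ _ gt with upper a≢b
  ... | i , isUpper , lt = i , (begin
    class' i (a , x) (a , y) ≡⟨ class'-within i a x y ⟩
    inner (a ⊕ i) a x y      ≡⟨ inner-max isUpper a x y ⟩
    inj₁ (a , max x y)       ≡⟨ cong (λ w → inj₁ (a , w)) (minBy-left depth {x} {y} (∸-monoʳ-< gt (<⇒≤ (toℕ<n x)))) ⟩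
    inj₁ (a , x)             ≡⟨ owns i a≢b lt ⟨
    class' i (a , x) (b , z) ∎)
    where open ≡-Reasoning

  covers' : ∀ {p q r} → p ≢ q → p ≢ r → ∃ λ i → class' i p q ≡ class' i p r
  covers' {a , x} {b , y} {c , z} p≢q p≢r = by-blocks (a Fin.≟ b) (a Fin.≟ c)
    where
    by-blocks : Dec (a ≡ b) → Dec (a ≡ c) →
                ∃ λ i → class' i (a , x) (b , y) ≡ class' i (a , x) (c , z)
    by-blocks (yes refl) (yes refl) with covers (p≢q ∘ cong (a ,_)) (p≢r ∘ cong (a ,_))
    -- Block `a` runs partition `j` of the given cover at the index that puts it at position
    -- `3 + j`.
    ... | j , eq with ⊕-solve a (suc (suc (suc j)))
    ...   | i , e = i , (begin
      class' i (a , x) (a , y)          ≡⟨ class'-within i a x y ⟩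
      inner (a ⊕ i) a x y               ≡⟨ cong (λ d → inner d a x y) e ⟩
      inj₂ (a , class j x y)            ≡⟨ cong (λ c → inj₂ (a , c)) eq ⟩
      inj₂ (a , class j x z)            ≡⟨ cong (λ d → inner d a x z) e ⟨
      inner (a ⊕ i) a x z               ≡⟨ class'-within i a x z ⟨
      class' i (a , x) (a , z)          ∎)
      where open ≡-Reasoning
    by-blocks (yes refl) (no a≢c) = mixed (p≢q ∘ cong (a ,_)) a≢c
    by-blocks (no a≢b) (yes refl) with mixed (p≢r ∘ cong (a ,_)) a≢b
    ... | i , eq = i , sym eq
    by-blocks (no a≢b) (no a≢c) with ⊕-solve a zero
    ... | i , eq = i , trans (owns-all i eq a≢b) (sym (owns-all i eq a≢c))

  blowup : Cover Vertex M
  blowup = record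
    { Class      = Class'
    ; _≟_        = ⊎-≡-dec (×-≡-dec Fin._≟_ Fin._≟_) (×-≡-dec Fin._≟_ _≟_)
    ; class      = class'
    ; class-sym  = class'-sym
    ; class-meet = λ i {u} {v} {u'} {v'} eq →
        shape-meet (shape i u v) (subst (Shape i u' v') (sym eq) (shape i u' v'))
    ; covers     = covers'
    }

  cover : Cover (Fin (M * n)) M
  cover = pullback (remQuot {M} n) injective blowup
    where
    injective : ∀ {x y} → remQuot {M} n x ≡ remQuot n y → x ≡ y
    injective {x} {y} eq = begin
      x                               ≡⟨ combine-remQuot {M} n x ⟨
      uncurry combine (remQuot {M} n x) ≡⟨ cong (uncurry combine) eq ⟩
      uncurry combine (remQuot {M} n y) ≡⟨ combine-remQuot {M} n y ⟩
      y                               ∎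
      where open ≡-Reasoning

-- The recursion for the bound

∏<-shift : ∀ t f → ∏< (suc t) f ≡ f 0 * ∏< t (f ∘ suc)
∏<-shift zero    f = *-comm 1 (f 0)
∏<-shift (suc t) f = begin
  ∏< (suc t) f * f (suc t)              ≡⟨ cong (_* f (suc t)) (∏<-shift t f) ⟩
  f 0 * ∏< t (f ∘ suc) * f (suc t)      ≡⟨ *-assoc (f 0) _ _ ⟩
  f 0 * (∏< t (f ∘ suc) * f (suc t))    ∎
  where open ≡-Reasoning

∏<-cong : ∀ t {f g} → (∀ i → f i ≡ g i) → ∏< t f ≡ ∏< t g
∏<-cong zero    eq = refl
∏<-cong (suc t) eq = cong₂ _*_ (∏<-cong t eq) (eq t)

⌈3+m/3⌉ : ∀ m → ⌈ 3 + m /3⌉ ≡ suc ⌈ m /3⌉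
⌈3+m/3⌉ m = +-distrib-/-∣ˡ (m + 2) {3} (divides-refl 1)

-- The factor at `0` is `4 + m`. At `suc i` the extra 3 comes off `4 + m`, leaving the factor for
-- `suc m` at `i`.
bound-step : ∀ m → bound (4 + m) ≡ (4 + m) * bound (suc m)
bound-step m = begin
  3 * ∏< (⌈ 4 + m /3⌉ ∸ 1) f      ≡⟨ cong (λ t → 3 * ∏< (t ∸ 1) f) (⌈3+m/3⌉ (suc m)) ⟩
  -- Subtraction truncates, so `1≤⌈⌉` is needed to write the number of factors as `suc s`.
  3 * ∏< ⌈ suc m /3⌉ f            ≡⟨ cong (λ t → 3 * ∏< t f) (m+[n∸m]≡n 1≤⌈⌉) ⟨
  3 * ∏< (suc s) f                ≡⟨ cong (3 *_) (∏<-shift s f) ⟩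
  3 * ((4 + m) * ∏< s (f ∘ suc))  ≡⟨ cong (λ x → 3 * ((4 + m) * x)) (∏<-cong s f-suc) ⟩
  3 * ((4 + m) * P)               ≡⟨ *-assoc 3 (4 + m) P ⟨
  3 * (4 + m) * P                 ≡⟨ cong (_* P) (*-comm 3 (4 + m)) ⟩
  (4 + m) * 3 * P                 ≡⟨ *-assoc (4 + m) 3 P ⟩
  (4 + m) * (3 * P)               ∎
  where
  open ≡-Reasoning
  f : ℕ → ℕ
  f i = 4 + m ∸ 3 * i

  s P : ℕ
  s = ⌈ suc m /3⌉ ∸ 1
  P = ∏< s (λ i → suc m ∸ 3 * i)

  1≤⌈⌉ : 1 ≤ ⌈ suc m /3⌉
  1≤⌈⌉ = m≥n⇒m/n>0 (s≤s (m≤n+m 2 m))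

  f-suc : ∀ i → f (suc i) ≡ suc m ∸ 3 * i
  f-suc i = trans (cong (4 + m ∸_) (*-suc 3 i)) ([m+n]∸[m+o]≡n∸o 3 (suc m) (3 * i))

-- Induction in steps of three from 1, 2 and 3 partitions, where the product is empty and the bound
-- evaluates to 3.
bound-cover : ∀ m → Cover (Fin (bound (suc m))) (suc m)
bound-cover 0 = triangle-cover 0
bound-cover 1 = triangle-cover 1
bound-cover 2 = triangle-cover 2
bound-cover (suc (suc (suc m))) =
  subst (λ n → Cover (Fin n) (4 + m)) (sym (bound-step m)) (Blowup.cover (bound-cover m))

theorem5 : (m : ℕ) → 1 ≤ m → ν≥ m (bound m)
theorem5 (suc m) _ = cover⇒ν≥ (bound-cover m)
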